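{- Let $a,b,\mu\in\mathbb{N}^{+}$ be positive integers with $a,b>1$, $\gcd(a-1,\mu)=1$ and $\gcd(b-1,\mu)=1$. Then the sequence $n\mapsto T(K_n;a,b)$ is ultimately periodic modulo $\mu$, where $T$ is the Tutte polynomial and $K_n$ is the complete graph on $n$ vertices.
   Context: For a finite graph $G=(V(G),E(G))$ and $A\subseteq E(G)$, let $\kappa(A)$ be the number of connected components of the spanning subgraph $(V(G),A)$, and let $\kappa(G)=\kappa(E(G))$. The Tutte polynomial is $$T(G;X,Y)=\sum_{A\subseteq E(G)}(X-1)^{\kappa(A)-\kappa(G)}\,(Y-1)^{|A|+\kappa(A)-|V(G)|}.$$ An integer sequence $(s_n)_{n\ge 1}$ is ultimately periodic modulo $\mu$ if there exist $N\ge 1$ and $p\ge 1$ such that $s_{n+p}\equiv s_n \pmod{\mu}$ for all $n\ge N$. -}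

module Defs where

open import Data.Fin.Base using (Fin; zero; suc; punchIn; punchOut)
open import Data.Fin.Properties using (_≟_; _<?_; punchInᵢ≢i; punchOut-punchIn; punchOut-cong; punchOut-injective; injective⇒≤)
open import Data.Fin.Subset using (Subset; _∈_; ∣_∣; inside; outside; ⊤)
open import Data.Fin.Subset.Properties using (∈⊤)
open import Data.Integer.Base as ℤ using (ℤ; +_; 0ℤ; 1ℤ)
open import Data.Integer.Divisibility using (_∣_)
open import Data.List.Base as List using (List)
open import Data.Nat.Base as ℕ using (ℕ; zero; suc; _≤_; _∸_)
import Data.Nat.Properties as ℕ
open import Data.Product.Base using (_×_; _,_; ∃-syntax; proj₁; proj₂; uncurry)
open import Data.Sum.Base using (_⊎_; inj₁; inj₂)
open import Data.Vec.Base as Vec using (Vec; []; _∷_; lookup; here; there)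
open import Function.Base using (id; _∘_)
open import Function.Bundles using (_⇔_; mk⇔; Equivalence)
open import Function.Definitions using (Surjective)
open import Relation.Binary.Construct.Closure.Equivalence as EqC using (EqClosure)
open import Relation.Binary.Construct.Closure.ReflexiveTransitive using (ε)
open import Relation.Binary.PropositionalEquality using (_≡_; _≢_; refl; sym; trans; cong; isEquivalence)
open import Relation.Nullary.Decidable.Core using (yes; no)
open import Relation.Nullary.Negation.Core using (contradiction)

------------------------------------------------------------------------
-- Finite graphs

-- The vertex set is Fin order and the edge set is Fin size; edges gives
-- the two ends of each edge.  The order in which the ends are listed is
-- irrelevant.  Loops and parallel edges are allowed.

record Graph : Set where
  constructor graph
  field
    order : ℕ
    size  : ℕ
    edges : Vec (Fin order × Fin order) size

K : ℕ → Graph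
K n = graph n (List.length pairs) (Vec.fromList pairs)
  where
  pairs : List (Fin n × Fin n)
  pairs = List.filter (uncurry _<?_) (List.cartesianProduct (List.allFin n) (List.allFin n))

------------------------------------------------------------------------
-- Connected components of spanning subgraphs

module _ {n m : ℕ} (es : Vec (Fin n × Fin n) m) (A : Subset m) where

  Adjacent : Fin n → Fin n → Set
  Adjacent i j = ∃[ e ] (e ∈ A × lookup es e ≡ (i , j))

  Connected : Fin n → Fin n → Set
  Connected = EqClosure Adjacent

  -- A numbering of the classes of Connected; it determines count.
  record Components : Set where
    field
      count      : ℕ
      component  : Fin n → Fin count
      surjective : Surjective _≡_ _≡_ component
      kernel     : ∀ {i j} → component i ≡ component j ⇔ Connected i j

open Components

-- Identify x with y, keeping the remaining elements distinct.
module Collapse {k : ℕ} {x y : Fin (suc k)} (x≢y : x ≢ y) where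

  collapse : Fin (suc k) → Fin k
  collapse z with x ≟ z
  ... | yes _   = punchOut x≢y
  ... | no  x≢z = punchOut x≢z

  collapse-≡ : collapse x ≡ collapse y
  collapse-≡ with x ≟ x | x ≟ y
  ... | _       | yes x≡y = contradiction x≡y x≢y
  ... | no x≢x  | _       = contradiction refl x≢x
  ... | yes _   | no  _   = punchOut-cong x refl

  collapse-kernel : ∀ z w → collapse z ≡ collapse w →
                    z ≡ w ⊎ (x ≡ z × y ≡ w) ⊎ (x ≡ w × y ≡ z)
  collapse-kernel z w eq with x ≟ z | x ≟ w
  ... | yes x≡z | yes x≡w = inj₁ (trans (sym x≡z) x≡w)
  ... | yes x≡z | no  x≢w = inj₂ (inj₁ (x≡z , punchOut-injective x≢y x≢w eq))
  ... | no  x≢z | yes x≡w = inj₂ (inj₂ (x≡w , sym (punchOut-injective x≢z x≢y eq)))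
  ... | no  x≢z | no  x≢w = inj₁ (punchOut-injective x≢z x≢w eq)

  collapse-punchIn : ∀ j → collapse (punchIn x j) ≡ j
  collapse-punchIn j with x ≟ punchIn x j
  ... | yes x≡ = contradiction (sym x≡) (punchInᵢ≢i x j)
  ... | no  x≢ = trans (punchOut-cong x refl) (punchOut-punchIn x)

weaken : ∀ {n m} {es : Vec (Fin n × Fin n) m} {A : Subset m} {p s i j} →
         Connected es A i j → Connected (p ∷ es) (s ∷ A) i j
weaken = EqC.map λ (e , e∈A , eq) → suc e , there e∈A , eq

-- The classes are unchanged by a new edge that is not selected.
skip : ∀ {n m} {es : Vec (Fin n × Fin n) m} {A : Subset m} p →
       Components es A → Components (p ∷ es) (outside ∷ A)
skip p C = record
  { count      = count C
  ; component  = component C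
  ; surjective = surjective C
  ; kernel     = mk⇔ (weaken ∘ Equivalence.to (kernel C))
                     (EqC.gfold isEquivalence (component C) λ where
                        (zero  , ()        , _)
                        (suc e , there e∈A , eq)   →
                          Equivalence.from (kernel C) (EqC.return (e , e∈A , eq)))
  }

module _ {n m} {es : Vec (Fin n × Fin n) m} {A : Subset m} (u v : Fin n) where

  link : Connected ((u , v) ∷ es) (inside ∷ A) u v
  link = EqC.return (zero , here , refl)

  -- A selected edge inside one class changes nothing; otherwise it
  -- merges the classes of its ends.
  insert : Components es A → Components ((u , v) ∷ es) (inside ∷ A)
  insert record { count = k ; component = f ; surjective = f-surj ; kernel = f-ker } with f u ≟ f v
  ... | yes fu≡fv = record
    { count      = k
    ; component  = f
    ; surjective = f-surj
    ; kernel     = mk⇔ (weaken ∘ Equivalence.to f-ker)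
                       (EqC.gfold isEquivalence f λ where
                          (zero  , here      , refl) → fu≡fv
                          (suc e , there e∈A , eq)   →
                            Equivalence.from f-ker (EqC.return (e , e∈A , eq)))
    }
  insert record { count = zero ; component = f } | no _ with () ← f u
  insert record { count = suc k ; component = f ; surjective = f-surj ; kernel = f-ker } | no fu≢fv = record
    { count      = k
    ; component  = collapse ∘ f
    ; surjective = λ c → let i , fi≡ = f-surj (punchIn (f u) c) in
                     i , λ { refl → trans (cong collapse (fi≡ refl)) (collapse-punchIn c) }
    ; kernel     = mk⇔ to
                       (EqC.gfold isEquivalence (collapse ∘ f) λ where
                          (zero  , here      , refl) → collapse-≡
                          (suc e , there e∈A , eq)   →
                            cong collapse (Equivalence.from f-ker (EqC.return (e , e∈A , eq))))
    }
    where
    open Collapse fu≢fv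
    E = Adjacent ((u , v) ∷ es) (inside ∷ A)

    to : ∀ {i j} → collapse (f i) ≡ collapse (f j) → EqClosure E i j
    to {i} {j} eq with collapse-kernel (f i) (f j) eq
    ... | inj₁ fi≡fj               = weaken (Equivalence.to f-ker fi≡fj)
    ... | inj₂ (inj₁ (u~i , v~j)) =
      EqC.transitive E (weaken (Equivalence.to f-ker (sym u~i)))
        (EqC.transitive E link (weaken (Equivalence.to f-ker v~j)))
    ... | inj₂ (inj₂ (u~j , v~i)) =
      EqC.transitive E (weaken (Equivalence.to f-ker (sym v~i)))
        (EqC.transitive E (EqC.symmetric E link) (weaken (Equivalence.to f-ker u~j)))

components : ∀ {n m} (es : Vec (Fin n × Fin n) m) (A : Subset m) → Components es A
components {n} [] [] = record
  { count      = n
  ; component  = id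
  ; surjective = λ i → i , id
  ; kernel     = mk⇔ (λ { refl → ε }) (EqC.gfold isEquivalence id λ { (() , _) })
  }
components (p       ∷ es) (outside ∷ A) = skip p (components es A)
components ((u , v) ∷ es) (inside  ∷ A) = insert u v (components es A)

------------------------------------------------------------------------
-- The Tutte polynomial

subsets : ∀ m → List (Subset m)
subsets zero    = [] List.∷ List.[]
subsets (suc m) = List.map (outside ∷_) (subsets m) List.++ List.map (inside ∷_) (subsets m)

sumℤ : List ℤ → ℤ
sumℤ = List.foldr ℤ._+_ 0ℤ

module _ (G : Graph) where
  open Graph G

  κ : Subset size → ℕ
  κ A = count (components edges A)

  -- The truncated subtractions below are exact, by κ-⊤ and order≤.
  T : ℤ → ℤ → ℤ
  T X Y = sumℤ (List.map term (subsets size))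
    where
    term : Subset size → ℤ
    term A = (X ℤ.- 1ℤ) ℤ.^ (κ A ∸ κ ⊤) ℤ.* (Y ℤ.- 1ℤ) ℤ.^ ((∣ A ∣ ℕ.+ κ A) ∸ order)

  κ-⊤ : ∀ A → κ ⊤ ≤ κ A
  κ-⊤ A = injective⇒≤ {f = f} λ {c} {d} eq → trans (sym (rep-≡ c))
    (trans (Equivalence.from (kernel all)
             (EqC.map (λ (e , _ , p) → e , ∈⊤ , p) (Equivalence.to (kernel some) eq)))
           (rep-≡ d))
    where
    all  = components edges ⊤
    some = components edges A

    rep : Fin (κ ⊤) → Fin order
    rep c = proj₁ (surjective all c)

    rep-≡ : ∀ c → component all (rep c) ≡ c
    rep-≡ c = proj₂ (surjective all c) refl

    f : Fin (κ ⊤) → Fin (κ A)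
    f = component some ∘ rep

insert-count : ∀ {n m} {es : Vec (Fin n × Fin n) m} {A : Subset m} u v
               (C : Components es A) → count C ≤ suc (count (insert u v C))
insert-count u v record { count = k ; component = f } with f u ≟ f v
... | yes _ = ℕ.n≤1+n k
insert-count u v record { count = zero ; component = f } | no _ with () ← f u
insert-count u v record { count = suc k } | no _ = ℕ.≤-refl

bound : ∀ {n m} (es : Vec (Fin n × Fin n) m) A → n ≤ ∣ A ∣ ℕ.+ count (components es A)
bound []             []            = ℕ.≤-refl
bound (_ ∷ es)       (outside ∷ A) = bound es A
bound ((u , v) ∷ es) (inside  ∷ A) =
  ℕ.≤-trans (bound es A)
    (ℕ.≤-trans (ℕ.+-monoʳ-≤ ∣ A ∣ (insert-count u v (components es A)))
               (ℕ.≤-reflexive (ℕ.+-suc ∣ A ∣ _)))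

order≤ : ∀ G A → Graph.order G ≤ ∣ A ∣ ℕ.+ κ G A
order≤ G = bound (Graph.edges G)

------------------------------------------------------------------------
-- Ultimate periodicity

-- Sequences are indexed from 1: since N ≥ 1, the value s 0 is irrelevant.
UltimatelyPeriodicMod : ℕ → (ℕ → ℤ) → Set
UltimatelyPeriodicMod μ s =
  ∃[ N ] ∃[ p ] (1 ≤ N × 1 ≤ p × ∀ n → N ≤ n → + μ ∣ s (n ℕ.+ p) ℤ.- s n)

{-# OPTIONS --safe #-}

-- Put x = a − 1, y = b − 1 and q = x y.  By the Fortuin–Kasteleyn expansion,
-- x yⁿ T(Kₙ; a, b) = Σ_A q^κ(A) y^|A| is the partition function of the Potts
-- model on Kₙ: the sum over all colourings σ : [n] → [q] of the product over
-- edges ij of w(σ i, σ j), where w = b on equal colours and 1 otherwise.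
-- Colouring one vertex c multiplies the weight of each colour d at all the other
-- vertices by w(c, d), so the partition functions Zₙ(g) with vertex weights
-- g : [q] → ℤ satisfy Zₙ₊₁(g) = Σ_c g(c) Zₙ(g · w(c, ·)).  Modulo μ the function
-- Zₙ is determined by its values on the finite set (ℤ/μ)^q and determines
-- Zₙ₊₁, hence by the pigeonhole principle Zₙ and yⁿ are simultaneously
-- ultimately periodic.  Finally x and y are cancelled, being units modulo μ.
module Submission where

open import Defs
open import Data.Bool.Base using (true; false; if_then_else_)
open import Data.Fin.Base as Fin using (Fin; zero; suc; toℕ; fromℕ<; punchOut; combine; finToFun; funToFin)
import Data.Fin.Properties as Fin
open import Data.Fin.Subset using (Subset; ∣_∣; inside; outside; ⊤)
open import Data.Fin.Subset.Properties using (∈⊤)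
open import Data.Integer.Base using (ℤ; +_; 0ℤ; 1ℤ; _+_; _*_; _-_; -_; _^_)
open import Data.Integer.Coprimality using (Coprime; coprime-divisor)
open import Data.Integer.Divisibility.Signed
open import Data.Integer.DivMod using (_%ℕ_; n%ℕd<d; a≡a%ℕn+[a/ℕn]*n; _/ℕ_)
open import Data.Integer.Properties
open import Data.Integer.Tactic.RingSolver using (solve-∀)
open import Data.List.Base as List using (List; []; _∷_; _++_; allFin; cartesianProduct)
open import Data.List.Membership.Propositional.Properties using (∈-filter⁺; ∈-cartesianProduct⁺; ∈-allFin)
import Data.List.Properties as List
open import Data.Nat.Base as ℕ using (ℕ; zero; suc; _∸_; _<_; z≤n; s≤s)
import Data.Nat.Coprimality as ℕ
open import Data.Nat.GCD using (gcd)
import Data.Nat.Properties as ℕ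
open import Data.Product.Base using (_×_; _,_; ∃-syntax; uncurry)
open import Data.Vec.Base as Vec using (Vec; []; _∷_; lookup; insertAt; tabulate; toList; fromList)
open import Data.Vec.Membership.Propositional.Properties using (∈-fromList⁺)
import Data.Vec.Properties as Vec
open import Data.Vec.Relation.Unary.Any as Any using ()
open import Data.Vec.Relation.Unary.Any.Properties using (lookup-index)
open import Function.Base using (_∘_; const)
open import Function.Bundles using (Equivalence)
open import Relation.Binary.Construct.Closure.Equivalence as EqC using ()
open import Relation.Binary.PropositionalEquality
open import Relation.Nullary.Decidable using (does; yes; no; dec-true)

import Algebra.Properties.Semiring.Sum +-*-semiring as Sum
open Sum using (sum; sum-cong-≗)
open ≡-Reasoning
open Components

-- Products over lists and over the pairs i < j.

∏ : ∀ {A : Set} → (A → ℤ) → List A → ℤ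
∏ f = List.foldr (λ x → f x *_) 1ℤ

∏-map : ∀ {A B : Set} (f : B → ℤ) (g : A → B) xs → ∏ f (List.map g xs) ≡ ∏ (f ∘ g) xs
∏-map f g []       = refl
∏-map f g (x ∷ xs) = cong (f (g x) *_) (∏-map f g xs)

∏-++ : ∀ {A : Set} (f : A → ℤ) xs ys → ∏ f (xs ++ ys) ≡ ∏ f xs * ∏ f ys
∏-++ f []       ys = sym (*-identityˡ _)
∏-++ f (x ∷ xs) ys = trans (cong (f x *_) (∏-++ f xs ys)) (sym (*-assoc (f x) _ _))

∏-cong : ∀ {A : Set} {f g : A → ℤ} → f ≗ g → ∏ f ≗ ∏ g
∏-cong f≗g []       = refl
∏-cong f≗g (x ∷ xs) = cong₂ _*_ (f≗g x) (∏-cong f≗g xs)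

∏-* : ∀ {A : Set} (f g : A → ℤ) xs → ∏ (λ x → f x * g x) xs ≡ ∏ f xs * ∏ g xs
∏-* f g []       = refl
∏-* f g (x ∷ xs) = trans (cong (f x * g x *_) (∏-* f g xs)) (interchange (f x) (g x) _ _)
  where
  interchange : ∀ i j k l → (i * j) * (k * l) ≡ (i * k) * (j * l)
  interchange = solve-∀

∏-allFin-suc : ∀ {n} (f : Fin (suc n) → ℤ) →
               ∏ f (allFin (suc n)) ≡ f zero * ∏ (f ∘ suc) (allFin n)
∏-allFin-suc {n} f = cong (f zero *_) (begin
  ∏ f (List.tabulate suc)         ≡⟨ cong (∏ f) (List.map-tabulate (λ i → i) suc) ⟨
  ∏ f (List.map suc (allFin n))   ≡⟨ ∏-map f suc (allFin n) ⟩
  ∏ (f ∘ suc) (allFin n)          ∎)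

∏-lookup : ∀ {A : Set} {n} (f : A → ℤ) (xs : Vec A n) → ∏ (f ∘ lookup xs) (allFin n) ≡ ∏ f (toList xs)
∏-lookup f []       = refl
∏-lookup f (x ∷ xs) = trans (∏-allFin-suc (f ∘ lookup (x ∷ xs))) (cong (f x *_) (∏-lookup f xs))

-- The list local to the definition of K.
pairs : ∀ n → List (Fin n × Fin n)
pairs n = List.filter (uncurry Fin._<?_) (cartesianProduct (allFin n) (allFin n))

module _ {n} (f : Fin n → Fin n → ℤ) where

  -- Padding with 1 on and below the diagonal turns the product over the filtered list into a full
  -- double product, whose first row and column can be split off.
  upper : Fin n → Fin n → ℤ
  upper i j = if does (i Fin.<? j) then f i j else 1ℤ

  ∏-filter-< : ∀ ps → ∏ (uncurry f) (List.filter (uncurry Fin._<?_) ps) ≡ ∏ (uncurry upper) ps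
  ∏-filter-< []             = refl
  ∏-filter-< ((i , j) ∷ ps) with does (i Fin.<? j)
  ... | true  = cong (f i j *_) (∏-filter-< ps)
  ... | false = trans (∏-filter-< ps) (sym (*-identityˡ _))

∏-cartesianProduct : ∀ {A B : Set} (f : A → B → ℤ) xs ys →
                     ∏ (uncurry f) (cartesianProduct xs ys) ≡ ∏ (λ x → ∏ (f x) ys) xs
∏-cartesianProduct f []       ys = refl
∏-cartesianProduct f (x ∷ xs) ys = begin
  ∏ (uncurry f) (List.map (x ,_) ys ++ cartesianProduct xs ys)
    ≡⟨ ∏-++ (uncurry f) (List.map (x ,_) ys) _ ⟩
  ∏ (uncurry f) (List.map (x ,_) ys) * ∏ (uncurry f) (cartesianProduct xs ys)
    ≡⟨ cong₂ _*_ (∏-map (uncurry f) (x ,_) ys) (∏-cartesianProduct f xs ys) ⟩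
  ∏ (f x) ys * ∏ (λ x → ∏ (f x) ys) xs ∎

∏-pairs : ∀ {n} (f : Fin n → Fin n → ℤ) →
          ∏ (uncurry f) (pairs n) ≡ ∏ (λ i → ∏ (upper f i) (allFin n)) (allFin n)
∏-pairs {n} f = trans (∏-filter-< f (cartesianProduct (allFin n) (allFin n)))
                      (∏-cartesianProduct (upper f) (allFin n) (allFin n))

∏-pairs-suc : ∀ {n} (f : Fin (suc n) → Fin (suc n) → ℤ) →
              ∏ (uncurry f) (pairs (suc n)) ≡
              ∏ (f zero ∘ suc) (allFin n) * ∏ (uncurry λ i j → f (suc i) (suc j)) (pairs n)
∏-pairs-suc {n} f = begin
  ∏ (uncurry f) (pairs (suc n))
    ≡⟨ ∏-pairs f ⟩
  ∏ (λ i → ∏ (upper f i) (allFin (suc n))) (allFin (suc n))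
    ≡⟨ ∏-allFin-suc (λ i → ∏ (upper f i) (allFin (suc n))) ⟩
  ∏ (upper f zero) (allFin (suc n)) * ∏ (λ i → ∏ (upper f (suc i)) (allFin (suc n))) (allFin n)
    ≡⟨ cong₂ _*_ (dropHead zero) (∏-cong (dropHead ∘ suc) (allFin n)) ⟩
  ∏ (f zero ∘ suc) (allFin n) * ∏ (λ i → ∏ (upper (λ i j → f (suc i) (suc j)) i) (allFin n)) (allFin n)
    ≡⟨ cong (∏ (f zero ∘ suc) (allFin n) *_) (∏-pairs (λ i j → f (suc i) (suc j))) ⟨
  ∏ (f zero ∘ suc) (allFin n) * ∏ (uncurry λ i j → f (suc i) (suc j)) (pairs n) ∎
  where
  -- No index lies below `zero`, so column `zero` contributes only factors 1.
  dropHead : ∀ i → ∏ (upper f i) (allFin (suc n)) ≡ ∏ (upper f i ∘ suc) (allFin n)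
  dropHead zero    = trans (∏-allFin-suc (upper f zero)) (*-identityˡ _)
  dropHead (suc i) = trans (∏-allFin-suc (upper f (suc i))) (*-identityˡ _)

-- Sums over colourings, and their behaviour when classes are merged.

δ : ∀ {q} → Fin q → Fin q → ℤ
δ c d = if does (c Fin.≟ d) then 1ℤ else 0ℤ

δ-refl : ∀ {q} (c : Fin q) → δ c c ≡ 1ℤ
δ-refl c rewrite dec-true (c Fin.≟ c) refl = refl

∑-δ : ∀ {q} (d : Fin q) (f : Fin q → ℤ) → sum (λ c → δ c d * f c) ≡ f d
∑-δ {suc q} zero    f = begin
  1ℤ * f zero + sum (λ c → 0ℤ * f (suc c)) ≡⟨ cong (_+ sum (λ c → 0ℤ * f (suc c))) (*-identityˡ (f zero)) ⟩
  f zero + sum {q} (λ _ → 0ℤ)              ≡⟨ cong (_+_ (f zero)) (Sum.sum-replicate-zero q) ⟩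
  f zero + 0ℤ                              ≡⟨ +-identityʳ (f zero) ⟩
  f zero                                   ∎
∑-δ {suc q} (suc d) f = trans (+-identityˡ _) (∑-δ d (f ∘ suc))

module Colourings (q : ℕ) where

  Colouring : ℕ → Set
  Colouring = Vec (Fin q)

  -- Nested sums, one for each vertex, so that the colour of the first vertex splits off by
  -- computation.
  ∑ᶜ : ∀ n → (Colouring n → ℤ) → ℤ
  ∑ᶜ zero    F = F []
  ∑ᶜ (suc n) F = sum λ c → ∑ᶜ n λ σ → F (c ∷ σ)

  ∑ᶜ-cong : ∀ n {F G : Colouring n → ℤ} → F ≗ G → ∑ᶜ n F ≡ ∑ᶜ n G
  ∑ᶜ-cong zero    F≗G = F≗G []
  ∑ᶜ-cong (suc n) F≗G = sum-cong-≗ λ c → ∑ᶜ-cong n (F≗G ∘ (c ∷_))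

  ∑ᶜ-+ : ∀ n (F G : Colouring n → ℤ) → ∑ᶜ n (λ σ → F σ + G σ) ≡ ∑ᶜ n F + ∑ᶜ n G
  ∑ᶜ-+ zero    F G = refl
  ∑ᶜ-+ (suc n) F G = trans (sum-cong-≗ λ c → ∑ᶜ-+ n (F ∘ (c ∷_)) (G ∘ (c ∷_)))
    (Sum.∑-distrib-+ (λ c → ∑ᶜ n (F ∘ (c ∷_))) (λ c → ∑ᶜ n (G ∘ (c ∷_))))

  ∑ᶜ-*ˡ : ∀ n i (F : Colouring n → ℤ) → ∑ᶜ n (λ σ → i * F σ) ≡ i * ∑ᶜ n F
  ∑ᶜ-*ˡ zero    i F = refl
  ∑ᶜ-*ˡ (suc n) i F = trans (sum-cong-≗ λ c → ∑ᶜ-*ˡ n i (F ∘ (c ∷_)))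
    (sym (Sum.*-distribˡ-sum i (λ c → ∑ᶜ n (F ∘ (c ∷_)))))

  ∑-∑ᶜ : ∀ {k} n (F : Fin k → Colouring n → ℤ) →
         sum (λ c → ∑ᶜ n (F c)) ≡ ∑ᶜ n (λ σ → sum λ c → F c σ)
  ∑-∑ᶜ zero    F = refl
  ∑-∑ᶜ (suc n) F = trans (Sum.∑-comm (λ c d → ∑ᶜ n (F c ∘ (d ∷_))))
    (sum-cong-≗ λ d → ∑-∑ᶜ n (λ c → F c ∘ (d ∷_)))

  -- Exchanging sums makes the colour at position `i` innermost, ready to be eliminated by a `δ`.
  ∑ᶜ-insertAt : ∀ n i (F : Colouring (suc n) → ℤ) →
                ∑ᶜ (suc n) F ≡ ∑ᶜ n (λ σ → sum λ c → F (insertAt σ i c))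
  ∑ᶜ-insertAt n       zero    F = ∑-∑ᶜ n (λ c → F ∘ (c ∷_))
  ∑ᶜ-insertAt (suc n) (suc i) F = sum-cong-≗ λ c → ∑ᶜ-insertAt n i (F ∘ (c ∷_))

  ∑ᶜ-1 : ∀ n → ∑ᶜ n (const 1ℤ) ≡ (+ q) ^ n
  ∑ᶜ-1 zero    = refl
  ∑ᶜ-1 (suc n) = begin
    sum {q} (λ _ → ∑ᶜ n (const 1ℤ)) ≡⟨ sum-cong-≗ {q} (λ _ → ∑ᶜ-1 n) ⟩
    sum {q} (λ _ → (+ q) ^ n)       ≡⟨ sum-const q ((+ q) ^ n) ⟩
    + q * (+ q) ^ n                 ∎
    where
    sum-const : ∀ k i → sum {k} (const i) ≡ + k * i
    sum-const zero    i = sym (*-zeroˡ i)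
    sum-const (suc k) i = trans (cong (_+_ i) (sum-const k i)) (sym (suc-* (+ k) i))

  infixr 9 _∙_
  -- Pullback of a colouring: with `f` a component map, `τ ∙ f` is constant on each component.
  _∙_ : ∀ {n k} → Colouring k → (Fin n → Fin k) → Colouring n
  τ ∙ f = tabulate (lookup τ ∘ f)

  module _ {k} {i j : Fin (suc k)} (i≢j : i ≢ j) where
    open Collapse i≢j

    insertAt-lookup-≢ : ∀ (τ : Colouring k) c {l} (i≢l : i ≢ l) →
      lookup (insertAt τ i c) l ≡ lookup τ (punchOut i≢l)
    insertAt-lookup-≢ τ c i≢l = trans
      (cong (lookup (insertAt τ i c)) (sym (Fin.punchIn-punchOut i≢l)))
      (Vec.insertAt-punchIn τ i c (punchOut i≢l))

    lookup-insertAt-collapse : ∀ (τ : Colouring k) l →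
      lookup (insertAt τ i (lookup τ (punchOut i≢j))) l ≡ lookup τ (collapse l)
    lookup-insertAt-collapse τ l with i Fin.≟ l
    ... | yes refl = Vec.insertAt-lookup τ i _
    ... | no  i≢l  = insertAt-lookup-≢ τ _ i≢l

    -- The `δ` leaves a single term in the sum over the colour of `i`, the one where it equals the
    -- colour of `j`. What remains is a colouring of the points other than `i`, pulled back along
    -- the identification of `i` with `j`.
    ∑ᶜ-collapse : ∀ {n} (f : Fin n → Fin (suc k)) (F : Colouring n → ℤ) →
      ∑ᶜ (suc k) (λ τ → δ (lookup τ i) (lookup τ j) * F (τ ∙ f)) ≡ ∑ᶜ k (λ τ → F (τ ∙ (collapse ∘ f)))
    ∑ᶜ-collapse f F = trans (∑ᶜ-insertAt k i λ τ → δ (lookup τ i) (lookup τ j) * F (τ ∙ f))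
      (∑ᶜ-cong k λ τ → let d = lookup τ (punchOut i≢j) in begin
      sum (λ c → δ (lookup (insertAt τ i c) i) (lookup (insertAt τ i c) j) * F (insertAt τ i c ∙ f))
        ≡⟨ sum-cong-≗ (λ c → cong (_* F (insertAt τ i c ∙ f))
             (cong₂ δ (Vec.insertAt-lookup τ i c) (insertAt-lookup-≢ τ c i≢j))) ⟩
      sum (λ c → δ c d * F (insertAt τ i c ∙ f))
        ≡⟨ ∑-δ d (λ c → F (insertAt τ i c ∙ f)) ⟩
      F (insertAt τ i d ∙ f)
        ≡⟨ cong F (Vec.tabulate-cong (lookup-insertAt-collapse τ ∘ f)) ⟩
      F (τ ∙ (collapse ∘ f)) ∎)

  -- If the ends already share a class, the factor is 1; otherwise it forces their two classes to
  -- have one colour, which is the effect of merging them.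
  ∑ᶜ-insert : ∀ {n m} {es : Vec (Fin n × Fin n) m} {A : Subset m} u v
    (C : Components es A) (F : Colouring n → ℤ) →
    ∑ᶜ (count (insert u v C)) (λ τ → F (τ ∙ component (insert u v C))) ≡
    ∑ᶜ (count C) (λ τ → δ (lookup τ (component C u)) (lookup τ (component C v)) * F (τ ∙ component C))
  -- Repeating the comparison made by `insert` lets its result compute.
  ∑ᶜ-insert u v record { count = k ; component = f } F with f u Fin.≟ f v
  ... | yes fu≡fv = ∑ᶜ-cong k λ τ → sym (begin
    δ (lookup τ (f u)) (lookup τ (f v)) * F (τ ∙ f) ≡⟨ cong (λ c → δ (lookup τ (f u)) (lookup τ c) * F (τ ∙ f)) fu≡fv ⟨
    δ (lookup τ (f u)) (lookup τ (f u)) * F (τ ∙ f) ≡⟨ cong (_* F (τ ∙ f)) (δ-refl (lookup τ (f u))) ⟩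
    1ℤ * F (τ ∙ f)                                  ≡⟨ *-identityˡ _ ⟩
    F (τ ∙ f)                                       ∎)
  ∑ᶜ-insert u v record { count = zero ; component = f } F | no _ with () ← f u
  ∑ᶜ-insert u v record { count = suc k ; component = f } F | no fu≢fv = sym (∑ᶜ-collapse fu≢fv f F)

-- Sums over sets of edges.

∑ˢ : ∀ m → (Subset m → ℤ) → ℤ
∑ˢ m f = sumℤ (List.map f (subsets m))

sumℤ-++ : ∀ is js → sumℤ (is ++ js) ≡ sumℤ is + sumℤ js
sumℤ-++ []       js = sym (+-identityˡ _)
sumℤ-++ (i ∷ is) js = trans (cong (_+_ i) (sumℤ-++ is js)) (sym (+-assoc i _ _))

∑ˢ-suc : ∀ m (f : Subset (suc m) → ℤ) →
         ∑ˢ (suc m) f ≡ ∑ˢ m (f ∘ (outside ∷_)) + ∑ˢ m (f ∘ (inside ∷_))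
∑ˢ-suc m f = begin
  sumℤ (List.map f (List.map (outside ∷_) (subsets m) ++ List.map (inside ∷_) (subsets m)))
    ≡⟨ cong sumℤ (List.map-++ f (List.map (outside ∷_) (subsets m)) _) ⟩
  sumℤ (List.map f (List.map (outside ∷_) (subsets m)) ++ List.map f (List.map (inside ∷_) (subsets m)))
    ≡⟨ sumℤ-++ (List.map f (List.map (outside ∷_) (subsets m))) _ ⟩
  sumℤ (List.map f (List.map (outside ∷_) (subsets m))) + sumℤ (List.map f (List.map (inside ∷_) (subsets m)))
    ≡⟨ cong₂ (λ is js → sumℤ is + sumℤ js) (List.map-∘ (subsets m)) (List.map-∘ (subsets m)) ⟨
  ∑ˢ m (f ∘ (outside ∷_)) + ∑ˢ m (f ∘ (inside ∷_)) ∎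

∑ˢ-cong : ∀ m {f g : Subset m → ℤ} → f ≗ g → ∑ˢ m f ≡ ∑ˢ m g
∑ˢ-cong m f≗g = cong sumℤ (List.map-cong f≗g (subsets m))

∑ˢ-*ˡ : ∀ m i (f : Subset m → ℤ) → ∑ˢ m (λ A → i * f A) ≡ i * ∑ˢ m f
∑ˢ-*ˡ m i f = go (subsets m)
  where
  go : ∀ As → sumℤ (List.map (λ A → i * f A) As) ≡ i * sumℤ (List.map f As)
  go []       = sym (*-zeroʳ i)
  go (A ∷ As) = trans (cong (_+_ (i * f A)) (go As)) (sym (*-distribˡ-+ i (f A) _))

∑ˢ-+ : ∀ m (f g : Subset m → ℤ) → ∑ˢ m (λ A → f A + g A) ≡ ∑ˢ m f + ∑ˢ m g
∑ˢ-+ m f g = go (subsets m)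
  where
  interchange : ∀ i j k l → (i + j) + (k + l) ≡ (i + k) + (j + l)
  interchange = solve-∀
  go : ∀ As → sumℤ (List.map (λ A → f A + g A) As) ≡ sumℤ (List.map f As) + sumℤ (List.map g As)
  go []       = refl
  go (A ∷ As) = trans (cong (_+_ (f A + g A)) (go As)) (interchange (f A) (g A) _ _)

-- The Potts model and its Fortuin-Kasteleyn expansion.

module Potts (q : ℕ) (y : ℤ) where
  open Colourings q

  weight : Fin q → Fin q → ℤ
  weight c d = 1ℤ + y * δ c d

  weights : ∀ {n m} → Vec (Fin n × Fin n) m → Colouring n → ℤ
  weights es σ = ∏ (uncurry λ u v → weight (lookup σ u) (lookup σ v)) (toList es)

  -- The sum of `F` over the colourings that are constant on every component of the spanning
  -- subgraph `A`, parametrised by the colours of the components.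
  pullbackSum : ∀ {n m} (es : Vec (Fin n × Fin n) m) → (Colouring n → ℤ) → Subset m → ℤ
  pullbackSum es F A = ∑ᶜ (count (components es A)) (λ τ → F (τ ∙ component (components es A)))

  -- Expands one edge at a time; the factor F absorbs the edges already
  -- treated.
  fortuin-kasteleyn : ∀ {n m} (es : Vec (Fin n × Fin n) m) (F : Colouring n → ℤ) →
    ∑ᶜ n (λ σ → weights es σ * F σ) ≡ ∑ˢ m (λ A → y ^ ∣ A ∣ * pullbackSum es F A)
  fortuin-kasteleyn {n} [] F = begin
    ∑ᶜ n (λ σ → 1ℤ * F σ)  ≡⟨ ∑ᶜ-*ˡ n 1ℤ F ⟩
    -- Without edges each vertex is its own component, and pulling back along the identity changes
    -- nothing.
    1ℤ * ∑ᶜ n F            ≡⟨ cong (1ℤ *_) (∑ᶜ-cong n λ σ → cong F (sym (Vec.tabulate∘lookup σ))) ⟩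
    1ℤ * pullbackSum [] F [] ≡⟨ +-identityʳ _ ⟨
    1ℤ * pullbackSum [] F [] + 0ℤ ∎
  fortuin-kasteleyn {n} {suc m} ((u , v) ∷ es) F = begin
    ∑ᶜ n (λ σ → weight (lookup σ u) (lookup σ v) * weights es σ * F σ)
      ≡⟨ ∑ᶜ-cong n (λ σ → regroup y (δᵘᵛ σ) (weights es σ) (F σ)) ⟩
    ∑ᶜ n (λ σ → weights es σ * (F σ + y * F′ σ))
      ≡⟨ fortuin-kasteleyn es (λ σ → F σ + y * F′ σ) ⟩
    ∑ˢ m (λ A → y ^ ∣ A ∣ * pullbackSum es (λ σ → F σ + y * F′ σ) A)
      ≡⟨ ∑ˢ-cong m split ⟩
    ∑ˢ m (λ A → y ^ ∣ A ∣ * pullbackSum es F A + y * y ^ ∣ A ∣ * pullbackSum ((u , v) ∷ es) F (inside ∷ A))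
      ≡⟨ ∑ˢ-+ m _ _ ⟩
    ∑ˢ m (λ A → y ^ ∣ A ∣ * pullbackSum es F A) +
    ∑ˢ m (λ A → y * y ^ ∣ A ∣ * pullbackSum ((u , v) ∷ es) F (inside ∷ A))
      -- An unselected edge keeps the component map by definition of `skip`, so the first sum is
      -- already the one over the sets avoiding the new edge.
      ≡⟨ ∑ˢ-suc m (λ A → y ^ ∣ A ∣ * pullbackSum ((u , v) ∷ es) F A) ⟨
    ∑ˢ (suc m) (λ A → y ^ ∣ A ∣ * pullbackSum ((u , v) ∷ es) F A) ∎
    where
    δᵘᵛ F′ : Colouring n → ℤ
    δᵘᵛ σ = δ (lookup σ u) (lookup σ v)
    F′ σ = δᵘᵛ σ * F σ

    regroup : ∀ y d w f → (1ℤ + y * d) * w * f ≡ w * (f + y * (d * f))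
    regroup = solve-∀

    distribute : ∀ y z i j → z * (i + y * j) ≡ z * i + y * z * j
    distribute = solve-∀

    selected : ∀ A → pullbackSum es F′ A ≡ pullbackSum ((u , v) ∷ es) F (inside ∷ A)
    selected A = trans
      (∑ᶜ-cong (count C) λ τ → cong (_* F (τ ∙ component C))
        (cong₂ δ (Vec.lookup∘tabulate _ u) (Vec.lookup∘tabulate _ v)))
      (sym (∑ᶜ-insert u v C F))
      where C = components es A

    split : ∀ A → y ^ ∣ A ∣ * pullbackSum es (λ σ → F σ + y * F′ σ) A ≡
                  y ^ ∣ A ∣ * pullbackSum es F A + y * y ^ ∣ A ∣ * pullbackSum ((u , v) ∷ es) F (inside ∷ A)
    split A = begin
      y ^ ∣ A ∣ * pullbackSum es (λ σ → F σ + y * F′ σ) A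
        ≡⟨ cong (y ^ ∣ A ∣ *_) (trans (∑ᶜ-+ k _ _) (cong (_+_ (pullbackSum es F A)) (∑ᶜ-*ˡ k y _))) ⟩
      y ^ ∣ A ∣ * (pullbackSum es F A + y * pullbackSum es F′ A)
        ≡⟨ distribute y (y ^ ∣ A ∣) _ _ ⟩
      y ^ ∣ A ∣ * pullbackSum es F A + y * y ^ ∣ A ∣ * pullbackSum es F′ A
        ≡⟨ cong (λ i → y ^ ∣ A ∣ * pullbackSum es F A + y * y ^ ∣ A ∣ * i) (selected A) ⟩
      y ^ ∣ A ∣ * pullbackSum es F A + y * y ^ ∣ A ∣ * pullbackSum ((u , v) ∷ es) F (inside ∷ A) ∎
      where k = count (components es A)

  -- For the constant function 1 the pulled back sum counts the colourings of the components.
  partition : ∀ {n m} (es : Vec (Fin n × Fin n) m) →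
    ∑ᶜ n (weights es) ≡ ∑ˢ m (λ A → y ^ ∣ A ∣ * (+ q) ^ count (components es A))
  partition {n} {m} es = begin
    ∑ᶜ n (weights es)                                         ≡⟨ ∑ᶜ-cong n (λ σ → sym (*-identityʳ _)) ⟩
    ∑ᶜ n (λ σ → weights es σ * 1ℤ)                            ≡⟨ fortuin-kasteleyn es (const 1ℤ) ⟩
    ∑ˢ m (λ A → y ^ ∣ A ∣ * pullbackSum es (const 1ℤ) A)      ≡⟨ ∑ˢ-cong m (λ A → cong (y ^ ∣ A ∣ *_) (∑ᶜ-1 (count (components es A)))) ⟩
    ∑ˢ m (λ A → y ^ ∣ A ∣ * (+ q) ^ count (components es A))  ∎

  -- The recursion for complete graphs with vertex weights.

  transfer : ℕ → (Fin q → ℤ) → ℤ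
  transfer zero    g = 1ℤ
  transfer (suc n) g = sum λ c → g c * transfer n (λ d → g d * weight c d)

  -- The edges at the first vertex give the first factor; the others form a complete graph on the
  -- remaining vertices.
  weights-K-suc : ∀ {n} c (σ : Colouring n) →
    weights (Graph.edges (K (suc n))) (c ∷ σ) ≡ ∏ (weight c) (toList σ) * weights (Graph.edges (K n)) σ
  weights-K-suc {n} c σ = begin
    ∏ (uncurry ω) (toList (fromList (pairs (suc n))))  ≡⟨ cong (∏ (uncurry ω)) (Vec.toList∘fromList (pairs (suc n))) ⟩
    ∏ (uncurry ω) (pairs (suc n))                      ≡⟨ ∏-pairs-suc ω ⟩
    ∏ (weight c ∘ lookup σ) (allFin n) * ∏ (uncurry λ i j → ω (suc i) (suc j)) (pairs n)
      ≡⟨ cong₂ _*_ (∏-lookup (weight c) σ) (cong (∏ (uncurry λ i j → ω (suc i) (suc j))) (sym (Vec.toList∘fromList (pairs n)))) ⟩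
    ∏ (weight c) (toList σ) * weights (Graph.edges (K n)) σ ∎
    where
    ω : Fin (suc n) → Fin (suc n) → ℤ
    ω i j = weight (lookup (c ∷ σ) i) (lookup (c ∷ σ) j)

  -- Induction with `g` arbitrary: once the first vertex has colour `c`, its edges multiply the
  -- vertex weights of all the others by `weight c`.
  ∑ᶜ-field-K : ∀ n g → ∑ᶜ n (λ σ → ∏ g (toList σ) * weights (Graph.edges (K n)) σ) ≡ transfer n g
  ∑ᶜ-field-K zero    g = refl
  ∑ᶜ-field-K (suc n) g = sum-cong-≗ λ c → begin
    ∑ᶜ n (λ σ → g c * ∏ g (toList σ) * weights (Graph.edges (K (suc n))) (c ∷ σ))
      ≡⟨ ∑ᶜ-cong n (λ σ → begin
        g c * ∏ g (toList σ) * weights (Graph.edges (K (suc n))) (c ∷ σ)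
          ≡⟨ cong (g c * ∏ g (toList σ) *_) (weights-K-suc c σ) ⟩
        g c * ∏ g (toList σ) * (∏ (weight c) (toList σ) * weights (Graph.edges (K n)) σ)
          ≡⟨ regroup (g c) (∏ g (toList σ)) _ _ ⟩
        g c * (∏ g (toList σ) * ∏ (weight c) (toList σ) * weights (Graph.edges (K n)) σ)
          ≡⟨ cong (λ i → g c * (i * weights (Graph.edges (K n)) σ)) (∏-* g (weight c) (toList σ)) ⟨
        g c * (∏ (λ d → g d * weight c d) (toList σ) * weights (Graph.edges (K n)) σ) ∎) ⟩
    ∑ᶜ n (λ σ → g c * (∏ (λ d → g d * weight c d) (toList σ) * weights (Graph.edges (K n)) σ))
      ≡⟨ ∑ᶜ-*ˡ n (g c) _ ⟩
    g c * ∑ᶜ n (λ σ → ∏ (λ d → g d * weight c d) (toList σ) * weights (Graph.edges (K n)) σ)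
      ≡⟨ cong (g c *_) (∑ᶜ-field-K n (λ d → g d * weight c d)) ⟩
    g c * transfer n (λ d → g d * weight c d) ∎
    where
    regroup : ∀ i j k l → i * j * (k * l) ≡ i * (j * k * l)
    regroup = solve-∀

  partition-K : ∀ n → ∑ᶜ n (weights (Graph.edges (K n))) ≡ transfer n (const 1ℤ)
  partition-K n = trans
    (∑ᶜ-cong n λ σ → sym (trans (cong (_* weights (Graph.edges (K n)) σ) (∏-1 (toList σ))) (*-identityˡ _)))
    (∑ᶜ-field-K n (const 1ℤ))
    where
    ∏-1 : ∀ {A : Set} (xs : List A) → ∏ (const 1ℤ) xs ≡ 1ℤ
    ∏-1 []       = refl
    ∏-1 (_ ∷ xs) = trans (*-identityˡ _) (∏-1 xs)

-- The Tutte polynomial of a complete graph as a partition function.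

κ-K : ∀ n → κ (K (suc n)) ⊤ ≡ 1
-- All classes coincide, so even the constant map to `Fin 1` is injective; this bounds their number
-- from above.
κ-K n = ℕ.≤-antisym (Fin.injective⇒≤ {f = const zero} λ {c} {d} _ → unique c d) (nonempty (component C zero))
  where
  C = components (Graph.edges (K (suc n))) ⊤

  nonempty : ∀ {k} → Fin k → 1 ℕ.≤ k
  nonempty {suc _} _ = s≤s z≤n

  const-component : ∀ j → component C zero ≡ component C j
  const-component zero    = refl
  const-component (suc j) = Equivalence.from (kernel C) (EqC.return (Any.index 0j∈ , ∈⊤ , sym (lookup-index 0j∈)))
    where
    -- The pair of `zero` and `suc j` passes the filter, so vertex `zero` is joined to every other
    -- vertex.
    0j∈ = ∈-fromList⁺ (∈-filter⁺ (uncurry Fin._<?_)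
      (∈-cartesianProduct⁺ (∈-allFin zero) (∈-allFin (suc j))) (s≤s z≤n))

  unique : ∀ c d → c ≡ d
  unique c d = let i , i↦c = surjective C c ; j , j↦d = surjective C d in
    trans (sym (i↦c refl)) (trans (sym (const-component i)) (trans (const-component j) (j↦d refl)))

-- As κ(G) = 1, the factor x completes the exponent κ(A) - 1 to κ(A), and the power of y cancels the
-- subtracted number of vertices. Each term becomes y^|A| (xy)^κ(A), with q = xy.
T-K : ∀ x y n → + x * (+ y) ^ suc n * T (K (suc n)) (+ suc x) (+ suc y) ≡
                Potts.transfer (x ℕ.* y) (+ y) (suc n) (const 1ℤ)
T-K x y n = begin
  + x * (+ y) ^ suc n * T G (+ suc x) (+ suc y)
    -- `+ suc x - 1ℤ` computes to `+ x`, and likewise for `y`, so the summands of `T` already have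
    -- the form required.
    ≡⟨ ∑ˢ-*ˡ (Graph.size G) (+ x * (+ y) ^ suc n) _ ⟨
  ∑ˢ (Graph.size G) (λ A → + x * (+ y) ^ suc n * ((+ x) ^ (κ G A ∸ κ G ⊤) * (+ y) ^ (∣ A ∣ ℕ.+ κ G A ∸ suc n)))
    ≡⟨ ∑ˢ-cong (Graph.size G) term ⟩
  ∑ˢ (Graph.size G) (λ A → (+ y) ^ ∣ A ∣ * (+ (x ℕ.* y)) ^ κ G A)
    ≡⟨ partition (Graph.edges G) ⟨
  ∑ᶜ (suc n) (weights (Graph.edges G))
    ≡⟨ partition-K (suc n) ⟩
  transfer (suc n) (const 1ℤ) ∎
  where
  open Potts (x ℕ.* y) (+ y)
  open Colourings (x ℕ.* y)
  G = K (suc n)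

  regroup : ∀ i j k l → i * j * (k * l) ≡ (i * k) * (j * l)
  regroup = solve-∀

  rotate : ∀ i j k → i * (j * k) ≡ j * (i * k)
  rotate = solve-∀

  ^-distribʳ-* : ∀ i j k → (i * j) ^ k ≡ i ^ k * j ^ k
  ^-distribʳ-* i j zero    = refl
  ^-distribʳ-* i j (suc k) = trans (cong (i * j *_) (^-distribʳ-* i j k)) (regroup i j (i ^ k) (j ^ k))

  term : ∀ A → + x * (+ y) ^ suc n * ((+ x) ^ (κ G A ∸ κ G ⊤) * (+ y) ^ (∣ A ∣ ℕ.+ κ G A ∸ suc n)) ≡
               (+ y) ^ ∣ A ∣ * (+ (x ℕ.* y)) ^ κ G A
  term A = begin
    + x * (+ y) ^ suc n * ((+ x) ^ (κ G A ∸ κ G ⊤) * (+ y) ^ (∣ A ∣ ℕ.+ κ G A ∸ suc n))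
      ≡⟨ regroup (+ x) ((+ y) ^ suc n) _ _ ⟩
    (+ x) ^ suc (κ G A ∸ κ G ⊤) * ((+ y) ^ suc n * (+ y) ^ (∣ A ∣ ℕ.+ κ G A ∸ suc n))
      ≡⟨ cong₂ _*_ (cong ((+ x) ^_) exponent)
           (trans (sym (^-distribˡ-+-* (+ y) (suc n) _)) (cong ((+ y) ^_) (ℕ.m+[n∸m]≡n (order≤ G A)))) ⟩
    (+ x) ^ κ G A * (+ y) ^ (∣ A ∣ ℕ.+ κ G A)
      ≡⟨ cong ((+ x) ^ κ G A *_) (^-distribˡ-+-* (+ y) ∣ A ∣ (κ G A)) ⟩
    (+ x) ^ κ G A * ((+ y) ^ ∣ A ∣ * (+ y) ^ κ G A)
      ≡⟨ rotate ((+ x) ^ κ G A) ((+ y) ^ ∣ A ∣) ((+ y) ^ κ G A) ⟩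
    (+ y) ^ ∣ A ∣ * ((+ x) ^ κ G A * (+ y) ^ κ G A)
      ≡⟨ cong ((+ y) ^ ∣ A ∣ *_) (trans (cong (_^ κ G A) (pos-* x y)) (^-distribʳ-* (+ x) (+ y) (κ G A))) ⟨
    (+ y) ^ ∣ A ∣ * (+ (x ℕ.* y)) ^ κ G A ∎
    where
    exponent : suc (κ G A ∸ κ G ⊤) ≡ κ G A
    exponent = subst (λ k → k ℕ.+ (κ G A ∸ κ G ⊤) ≡ κ G A) (κ-K n) (ℕ.m+[n∸m]≡n (κ-⊤ G A))

-- Congruences modulo μ.

module Modulo (μ : ℕ) .{{_ : ℕ.NonZero μ}} where

  infix 4 _≋_
  -- A record, so that both sides can be inferred from a congruence; the difference alone would not
  -- determine them.
  record _≋_ (i j : ℤ) : Set where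
    constructor divides-difference
    field difference : + μ ∣ i - j
  open _≋_ public

  ≋-reflexive : ∀ {i j} → i ≡ j → i ≋ j
  ≋-reflexive {i} refl = divides-difference (divides 0ℤ (i≡j⇒i-j≡0 {i} refl))

  ≋-sym : ∀ {i j} → i ≋ j → j ≋ i
  ≋-sym {i} {j} i≋j = divides-difference (subst (+ μ ∣_) (negate i j) (∣m⇒∣-m (difference i≋j)))
    where
    negate : ∀ i j → - (i - j) ≡ j - i
    negate = solve-∀

  ≋-trans : ∀ {i j k} → i ≋ j → j ≋ k → i ≋ k
  ≋-trans {i} {j} {k} i≋j j≋k = divides-difference
    (subst (+ μ ∣_) (telescope i j k) (∣m∣n⇒∣m+n (difference i≋j) (difference j≋k)))
    where
    telescope : ∀ i j k → (i - j) + (j - k) ≡ i - k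
    telescope = solve-∀

  +-cong-≋ : ∀ {i j k l} → i ≋ j → k ≋ l → i + k ≋ j + l
  +-cong-≋ {i} {j} {k} {l} i≋j k≋l = divides-difference
    (subst (+ μ ∣_) (regroup i j k l) (∣m∣n⇒∣m+n (difference i≋j) (difference k≋l)))
    where
    regroup : ∀ i j k l → (i - j) + (k - l) ≡ (i + k) - (j + l)
    regroup = solve-∀

  *-cong-≋ : ∀ {i j k l} → i ≋ j → k ≋ l → i * k ≋ j * l
  *-cong-≋ {i} {j} {k} {l} i≋j k≋l = divides-difference
    (subst (+ μ ∣_) (regroup i j k l) (∣m∣n⇒∣m+n (∣m⇒∣m*n k (difference i≋j)) (∣n⇒∣m*n j (difference k≋l))))
    where
    regroup : ∀ i j k l → (i - j) * k + j * (k - l) ≡ i * k - j * l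
    regroup = solve-∀

  sum-cong-mod : ∀ {n} {f g : Fin n → ℤ} → (∀ i → f i ≋ g i) → sum f ≋ sum g
  sum-cong-mod {zero}  f≋g = ≋-reflexive refl
  sum-cong-mod {suc n} f≋g = +-cong-≋ (f≋g zero) (sum-cong-mod (f≋g ∘ suc))

  *-congˡ-≋ : ∀ i {j k} → j ≋ k → i * j ≋ i * k
  *-congˡ-≋ i = *-cong-≋ (≋-reflexive {i} refl)

  -- Euclid's lemma applied to μ dividing i (j - k).
  *-cancelˡ-≋ : ∀ i {j k} → Coprime (+ μ) i → i * j ≋ i * k → j ≋ k
  *-cancelˡ-≋ i {j} {k} c ij≋ik = divides-difference (∣ᵤ⇒∣
    (coprime-divisor (+ μ) i (j - k) c (∣⇒∣ᵤ (subst (+ μ ∣_) (factor i j k) (difference ij≋ik)))))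
    where
    factor : ∀ i j k → i * j - i * k ≡ i * (j - k)
    factor = solve-∀

  ^-cancelˡ-≋ : ∀ i {j k} n → Coprime (+ μ) i → i ^ n * j ≋ i ^ n * k → j ≋ k
  ^-cancelˡ-≋ i {j} {k} zero    c eq = subst₂ _≋_ (*-identityˡ j) (*-identityˡ k) eq
  ^-cancelˡ-≋ i {j} {k} (suc n) c eq =
    ^-cancelˡ-≋ i n c (*-cancelˡ-≋ i c (subst₂ _≋_ (*-assoc i (i ^ n) j) (*-assoc i (i ^ n) k) eq))

  residue : ℤ → Fin μ
  residue i = fromℕ< (n%ℕd<d i μ)

  toℕ-residue : ∀ i → i ≋ + toℕ (residue i)
  toℕ-residue i = divides-difference (divides (i /ℕ μ) (begin
    i - + toℕ (residue i)
      ≡⟨ cong₂ (λ j r → j - + r) (a≡a%ℕn+[a/ℕn]*n i μ) (Fin.toℕ-fromℕ< (n%ℕd<d i μ)) ⟩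
    (+ (i %ℕ μ) + (i /ℕ μ) * + μ) - + (i %ℕ μ)
      ≡⟨ cancel (+ (i %ℕ μ)) _ ⟩
    (i /ℕ μ) * + μ ∎))
    where
    cancel : ∀ r j → (r + j) - r ≡ j
    cancel = solve-∀

  residue-injective : ∀ i j → residue i ≡ residue j → i ≋ j
  residue-injective i j eq =
    ≋-trans (toℕ-residue i) (≋-trans (≋-reflexive (cong (+_ ∘ toℕ) eq)) (≋-sym (toℕ-residue j)))

  -- Periodicity by the pigeonhole principle.

  module _ (q : ℕ) (y : ℤ) where
    open Potts q y

    -- Only sums and products are formed from the values of the field, so only their residues
    -- matter.
    transfer-cong : ∀ n {g h} → (∀ c → g c ≋ h c) → transfer n g ≋ transfer n h
    transfer-cong zero    g≋h = ≋-reflexive refl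
    transfer-cong (suc n) g≋h = sum-cong-mod λ c →
      *-cong-≋ (g≋h c) (transfer-cong n λ d → *-cong-≋ (g≋h d) (≋-reflexive refl))

    -- The fields modulo μ, numbered by a finite set and lifted to representatives in ℤ.
    residueField : Fin (μ ℕ.^ q) → Fin q → ℤ
    residueField i c = + toℕ (finToFun i c)

    -- The whole function Zₙ modulo μ, encoded as one element of a finite set.
    table : ℕ → Fin (μ ℕ.^ (μ ℕ.^ q))
    table n = funToFin λ i → residue (transfer n (residueField i))

    -- Every field is congruent to some `residueField i`, whose value the table records.
    table-≡ : ∀ m n → table m ≡ table n → ∀ g → transfer m g ≋ transfer n g
    table-≡ m n eq g =
      ≋-trans (transfer-cong m g≋) (≋-trans (residue-injective _ _ entry) (≋-sym (transfer-cong n g≋)))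
      where
      i = funToFin (residue ∘ g)

      g≋ : ∀ c → g c ≋ residueField i c
      g≋ c = ≋-trans (toℕ-residue (g c))
        (≋-reflexive (cong (+_ ∘ toℕ) (sym (Fin.finToFun-funToFin (residue ∘ g) c))))

      entry : residue (transfer m (residueField i)) ≡ residue (transfer n (residueField i))
      entry = begin
        residue (transfer m (residueField i)) ≡⟨ Fin.finToFun-funToFin (residue ∘ transfer m ∘ residueField) i ⟨
        finToFun (table m) i            ≡⟨ cong (λ t → finToFun t i) eq ⟩
        finToFun (table n) i            ≡⟨ Fin.finToFun-funToFin (residue ∘ transfer n ∘ residueField) i ⟩
        residue (transfer n (residueField i)) ∎

    -- Agreement is assumed for all fields because each step of the recursion evaluates at modified
    -- fields.
    transfer-+ : ∀ {m n} → (∀ g → transfer m g ≋ transfer n g) →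
                 ∀ k g → transfer (k ℕ.+ m) g ≋ transfer (k ℕ.+ n) g
    transfer-+         m≋n zero    g = m≋n g
    transfer-+ {m} {n} m≋n (suc k) g = sum-cong-mod λ c →
      *-congˡ-≋ (g c) (transfer-+ {m} {n} m≋n k λ d → g d * weight c d)

    ^-+ : ∀ {m n} → y ^ m ≋ y ^ n → ∀ k → y ^ (k ℕ.+ m) ≋ y ^ (k ℕ.+ n)
    ^-+         m≋n zero    = m≋n
    ^-+ {m} {n} m≋n (suc k) = *-congˡ-≋ y (^-+ {m} {n} m≋n k)

    eventually-periodic : ∃[ N ] ∃[ p ] (1 ℕ.≤ p × ∀ n → N ℕ.≤ n →
      y ^ (n ℕ.+ p) ≋ y ^ n × transfer (n ℕ.+ p) (const 1ℤ) ≋ transfer n (const 1ℤ))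
    -- `ℕ.≤-refl` takes one index more than there are codes. Pairing the residue of the power with
    -- the table makes one collision serve both sequences.
    eventually-periodic with Fin.pigeonhole ℕ.≤-refl (λ i → combine (residue (y ^ toℕ i)) (table (toℕ i)))
    ... | i′ , j′ , i<j , eq = i , j ∸ i , ℕ.m<n⇒0<n∸m i<j , λ n i≤n →
      -- The agreement at `j` and `i` is carried forward by `n ∸ i` steps.
      subst₂ (λ s t → y ^ s ≋ y ^ t) (shift n i≤n) (ℕ.m∸n+n≡m i≤n) (^-+ y^ⱼ≋y^ᵢ (n ∸ i)) ,
      subst₂ (λ s t → transfer s (const 1ℤ) ≋ transfer t (const 1ℤ)) (shift n i≤n) (ℕ.m∸n+n≡m i≤n)
        (transfer-+ (table-≡ j i (sym table-i≡j)) (n ∸ i) (const 1ℤ))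
      where
      i j : ℕ
      i = toℕ i′
      j = toℕ j′

      y^ⱼ≋y^ᵢ : y ^ j ≋ y ^ i
      y^ⱼ≋y^ᵢ = residue-injective (y ^ j) (y ^ i)
        (sym (Fin.combine-injectiveˡ (residue (y ^ i)) (table i) (residue (y ^ j)) (table j) eq))

      table-i≡j : table i ≡ table j
      table-i≡j = Fin.combine-injectiveʳ (residue (y ^ i)) (table i) (residue (y ^ j)) (table j) eq

      shift : ∀ n → i ℕ.≤ n → n ∸ i ℕ.+ j ≡ n ℕ.+ (j ∸ i)
      shift n i≤n = begin
        n ∸ i ℕ.+ j                          ≡⟨ cong (n ∸ i ℕ.+_) (ℕ.m+[n∸m]≡n (ℕ.<⇒≤ i<j)) ⟨
        n ∸ i ℕ.+ (i ℕ.+ (j ∸ i))    ≡⟨ ℕ.+-assoc (n ∸ i) (i) _ ⟨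
        n ∸ i ℕ.+ i ℕ.+ (j ∸ i)      ≡⟨ cong (ℕ._+ (j ∸ i)) (ℕ.m∸n+n≡m i≤n) ⟩
        n ℕ.+ (j ∸ i)                        ∎

-- Cancellation of the units x and y.

theorem1p5 : ∀ (a b μ : ℕ) → 0 < μ → 1 < a → 1 < b →
    gcd (a ∸ 1) μ ≡ 1 → gcd (b ∸ 1) μ ≡ 1 →
    UltimatelyPeriodicMod μ (λ n → T (K n) (+ a) (+ b))
theorem1p5 (suc x) (suc y) μ@(suc _) _ _ _ gcd-x gcd-y =
  let N , p , 1≤p , periodic = eventually-periodic (x ℕ.* y) (+ y) in
  -- The successor excludes n = 0, for which `T-K` is not stated.
  suc N , p , s≤s z≤n , 1≤p , λ where
    (suc n) N<n → let y^≋ , Z≋ = periodic (suc n) (ℕ.<⇒≤ N<n) in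
      ∣⇒∣ᵤ (difference (T-≋ n p y^≋ Z≋))
  where
  open Modulo μ

  τ Z : ℕ → ℤ
  τ n = T (K n) (+ suc x) (+ suc y)
  Z n = Potts.transfer (x ℕ.* y) (+ y) n (const 1ℤ)

  T-≋ : ∀ n p → (+ y) ^ (suc n ℕ.+ p) ≋ (+ y) ^ suc n → Z (suc n ℕ.+ p) ≋ Z (suc n) →
        τ (suc n ℕ.+ p) ≋ τ (suc n)
  T-≋ n p y^≋ Z≋ = ^-cancelˡ-≋ (+ y) (suc n) (ℕ.sym (ℕ.gcd≡1⇒coprime gcd-y))
    (*-cancelˡ-≋ (+ x) (ℕ.sym (ℕ.gcd≡1⇒coprime gcd-x))
      (subst₂ _≋_ (*-assoc (+ x) _ _) (*-assoc (+ x) _ _)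
        -- Both values of `τ` carry the same power of `y` for the cancellation; periodicity of the
        -- powers replaces the first by the longer power that `T-K` requires.
        (≋-trans (*-cong-≋ (*-congˡ-≋ (+ x) (≋-sym y^≋)) (≋-reflexive refl))
          (subst₂ _≋_ (sym (T-K x y (n ℕ.+ p))) (sym (T-K x y n)) Z≋))))
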